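{- Let $D$ be a digraph obtained from a tournament by deleting the edges of pairwise disjoint stars $S_1,\dots,S_n$ with centers $x_1,\dots,x_n$ respectively. Suppose that in the tournament $D[\{x_1,\dots,x_n\}]$ induced by the centers of the missing stars, every vertex is a king. If every vertex of the dependency digraph $\Delta$ of $D$ has in-degree at least $1$ in $\Delta$ (i.e. $\delta^-_\Delta>0$), then $D$ satisfies the second neighborhood conjecture, that is, there is a vertex $v\in V(D)$ with $d^+_D(v)\le d^{++}_D(v)$.
   Context: All digraphs are finite with nonempty vertex set. An oriented graph is a digraph without loops and without digons (directed cycles of length two); a tournament is an oriented graph in which every two distinct vertices are adjacent. Write $x\rightarrow y$ if $(x,y)$ is an arc. $N^+(v)$ is the set of out-neighbors of $v$ and $N^{++}(v)$ is the set of vertices at distance exactly $2$ from $v$ (reached from $v$ by a directed path of length 2 but not by one of length 0 or 1); $d^+(v)=|N^+(v)|$, $d^{++}(v)=|N^{++}(v)|$. For distinct vertices $x,y$ of $D$, $xy$ is a missing edge if neither $(x,y)$ nor $(y,x)$ is an arc of $D$. A star of center $x$ is a graph whose edge set has the form $\{a_ix : i=1,\dots,k\}$ with $k\ge 1$, the $a_i$ distinct and different from $x$ (when $k=1$, one of the two endpoints is designated as center). Stars are disjoint if no two of them share a vertex. Deleting the edges of the stars from a tournament means removing the arc joining the two endpoints of each star edge; thus the missing edges of $D$ are exactly the edges of $S_1,\dots,S_n$. A vertex $x$ of a tournament $T$ is a king if $\{x\}\cup N_T^+(x)\cup N_T^{++}(x)=V(T)$. Dependency digraph: for missing edges $e$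 and $e'$ of $D$, $e$ loses to $e'$ if the endpoints can be named $e=x_1y_1$, $e'=x_2y_2$ so that $x_1\rightarrow x_2$, $y_2\notin N^+(x_1)\cup N^{++}(x_1)$, $y_1\rightarrow y_2$ and $x_2\notin N^+(y_1)\cup N^{++}(y_1)$. The dependency digraph $\Delta$ of $D$ has the missing edges of $D$ as vertices, and an arc $(e,e')$ whenever $e$ loses to $e'$ (digons in $\Delta$ are allowed). -}

module Defs where

open import Data.Fin using (Fin; _<_)
open import Data.Fin.Properties using (_≟_; _<?_; any?)
open import Data.Fin.Subset
  using (Subset; _∈_; _∉_; _∩_; _∪_; ⁅_⁆; ⊤; ∣_∣; Nonempty; Empty)
open import Data.Fin.Subset.Properties using (_∈?_)
open import Data.List.Base
  using (List; []; _∷_; allFin; cartesianProduct; filter; length; lookup)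
open import Data.List.Relation.Unary.Any as Any using (Any)
open import Data.Nat.Base using (ℕ; _≤_)
open import Data.Product.Base using (∃; _×_; _,_)
open import Data.Sum.Base using (_⊎_)
open import Data.Vec.Base using (tabulate)
open import Function.Base using (_∘_)
open import Level using (0ℓ)
open import Relation.Binary.Core using (Rel)
import Relation.Binary.Definitions as B
open import Relation.Binary.PropositionalEquality using (_≡_; _≢_)
open import Relation.Nullary using (¬_; does; ¬?; _×-dec_; _⊎-dec_)
open import Relation.Unary using (Pred; Decidable)

private
  variable
    m n : ℕ

subset : {P : Pred (Fin m) 0ℓ} → Decidable P → Subset m
subset P? = tabulate (does ∘ P?)

record Digraph (m : ℕ) : Set₁ where
  field
    _⟶_  : Rel (Fin m) 0ℓ
    _⟶?_ : B.Decidable _⟶_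

record IsOriented (D : Digraph m) : Set where
  open Digraph D
  field
    noLoops  : ∀ x → ¬ (x ⟶ x)
    noDigons : ∀ x y → x ⟶ y → ¬ (y ⟶ x)

record IsTournament (D : Digraph m) : Set where
  open Digraph D
  field
    isOriented : IsOriented D
    adjacent   : ∀ x y → x ≢ y → (x ⟶ y) ⊎ (y ⟶ x)

-- For an injective family x this is (a copy, with x i renamed to i, of) the
-- subdigraph of D induced by the set of all x i.
induced : Digraph m → (Fin n → Fin m) → Digraph n
induced D x = record
  { _⟶_  = λ i j → x i ⟶ x j
  ; _⟶?_ = λ i j → x i ⟶? x j
  }
  where open Digraph D

module _ (D : Digraph m) where
  open Digraph D

  AtDistance2 : Rel (Fin m) 0ℓ
  AtDistance2 v w = v ≢ w × ¬ (v ⟶ w) × ∃ λ u → (v ⟶ u) × (u ⟶ w)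

  atDistance2? : B.Decidable AtDistance2
  atDistance2? v w =
    ¬? (v ≟ w) ×-dec ¬? (v ⟶? w) ×-dec any? (λ u → (v ⟶? u) ×-dec (u ⟶? w))

  N⁺ N⁺⁺ N⁻ : Fin m → Subset m
  N⁺  v = subset (λ w → v ⟶? w)
  N⁺⁺ v = subset (λ w → atDistance2? v w)
  N⁻  v = subset (λ w → w ⟶? v)

  d⁺ d⁺⁺ d⁻ : Fin m → ℕ
  d⁺  v = ∣ N⁺ v ∣
  d⁺⁺ v = ∣ N⁺⁺ v ∣
  d⁻  v = ∣ N⁻ v ∣

  IsKing : Pred (Fin m) 0ℓ
  IsKing x = ⁅ x ⁆ ∪ N⁺ x ∪ N⁺⁺ x ≡ ⊤

  SatisfiesSNC : Set
  SatisfiesSNC = ∃ λ v → d⁺ v ≤ d⁺⁺ v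

  Missing : Pred (Fin m × Fin m) 0ℓ
  Missing (x , y) = x ≢ y × ¬ (x ⟶ y) × ¬ (y ⟶ x)

  missing? : Decidable Missing
  missing? (x , y) = ¬? (x ≟ y) ×-dec ¬? (x ⟶? y) ×-dec ¬? (y ⟶? x)

  -- The unordered pair xy is listed exactly once, as the pair with x < y.
  missingEdges : List (Fin m × Fin m)
  missingEdges =
    filter (λ { (x , y) → (x <? y) ×-dec missing? (x , y) })
           (cartesianProduct (allFin m) (allFin m))

  LosesVia : Rel (Fin m × Fin m) 0ℓ
  LosesVia (x₁ , y₁) (x₂ , y₂) =
    (x₁ ⟶ x₂) × y₂ ∉ N⁺ x₁ ∪ N⁺⁺ x₁ ×
    (y₁ ⟶ y₂) × x₂ ∉ N⁺ y₁ ∪ N⁺⁺ y₁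

  losesVia? : B.Decidable LosesVia
  losesVia? (x₁ , y₁) (x₂ , y₂) =
    (x₁ ⟶? x₂) ×-dec ¬? (y₂ ∈? N⁺ x₁ ∪ N⁺⁺ x₁) ×-dec
    (y₁ ⟶? y₂) ×-dec ¬? (x₂ ∈? N⁺ y₁ ∪ N⁺⁺ y₁)

  namings : Fin m × Fin m → List (Fin m × Fin m)
  namings (x , y) = (x , y) ∷ (y , x) ∷ []

  LosesTo : Rel (Fin m × Fin m) 0ℓ
  LosesTo e e′ = Any (λ p → Any (LosesVia p) (namings e′)) (namings e)

  losesTo? : B.Decidable LosesTo
  losesTo? e e′ = Any.any? (λ p → Any.any? (losesVia? p) (namings e′)) (namings e)

  -- Vertices are the positions in the duplicate-free list of missing edges.
  Δ : Digraph (length missingEdges)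
  Δ = record
    { _⟶_  = λ i j → LosesTo  (lookup missingEdges i) (lookup missingEdges j)
    ; _⟶?_ = λ i j → losesTo? (lookup missingEdges i) (lookup missingEdges j)
    }

-- The star with edges {a, center} for a ∈ leaves.
record Star (m : ℕ) : Set where
  field
    center        : Fin m
    leaves        : Subset m
    nonempty      : Nonempty leaves
    center∉leaves : center ∉ leaves

  vertices : Subset m
  vertices = ⁅ center ⁆ ∪ leaves

  Edge : Rel (Fin m) 0ℓ
  Edge u v = (u ≡ center × v ∈ leaves) ⊎ (v ≡ center × u ∈ leaves)

  edge? : B.Decidable Edge
  edge? u v =
    ((u ≟ center) ×-dec (v ∈? leaves)) ⊎-dec ((v ≟ center) ×-dec (u ∈? leaves))

open Star public using (center)

PairwiseDisjoint : (Fin n → Star m) → Set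
PairwiseDisjoint S =
  ∀ i j → i ≢ j → Empty (Star.vertices (S i) ∩ Star.vertices (S j))

_∖_ : Digraph m → (Fin n → Star m) → Digraph m
T ∖ S = record
  { _⟶_  = λ u v → (u ⟶ v) × ¬ (∃ λ i → Star.Edge (S i) u v)
  ; _⟶?_ = λ u v → (u ⟶? v) ×-dec ¬? (any? λ i → Star.edge? (S i) u v)
  }
  where open Digraph T

{-# OPTIONS --safe #-}
module Submission where

-- Complete D to a tournament by directing every missing edge from its leaf to its center,
-- and order the vertices so that as many arcs as possible point forward (a median order).
-- As in Havet and Thomassé's proof for tournaments, local optimality at the last vertex v
-- gives d⁺ v ≤ d⁺⁺ v in the completion; it remains to return to D. A vertex x that v
-- reaches in two steps only through a new arc r → x is a center, so v may be assumed not
-- to be a center, since all centers are kings. If the edge c a loses to x r, then c → x and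
-- v is not an out-neighbor of c, so x is reached through c after all, unless v is itself a
-- leaf at c. In that case at most one x is lost, and this is paid for by the arc from v to its
-- center, which lies at distance 2 from v in D.

open import Data.Empty using (⊥)
open import Data.Fin.Base as Fin using (Fin; zero; suc; fromℕ<)
open import Data.Fin.Properties using (_≟_; any?; <-cmp)
open import Data.Fin.Subset using (Subset; _∈_; _∉_; _∪_; ⁅_⁆; ∣_∣; Nonempty)
open import Data.Fin.Subset.Properties
  using (_∈?_; ∈⊤; Empty-unique; ∣⊥∣≡0; nonempty?; x∈⁅x⁆; x∈⁅y⁆⇒x≡y;
         x∈p∩q⁺; x∈p∪q⁻; x∈p∪q⁺)
open import Data.List.Base as List
  using (List; []; _∷_; [_]; _++_; _∷ʳ_; allFin; filter; length; initLast; _∷ʳ′_)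
open import Data.List.Membership.Propositional using () renaming (_∈_ to _∈ˡ_)
open import Data.List.Membership.Propositional.Properties
  using (∈-allFin; ∈-filter⁺; ∈-filter⁻; ∈-cartesianProduct⁺; ∈-lookup)
open import Data.List.Properties
  using (++-assoc; ++-identityʳ; filter-++; filter-accept; filter-reject;
         length-++; length-filter)
open import Data.List.Relation.Binary.Permutation.Propositional
  using (_↭_; prep; ↭-refl; ↭-sym; ↭-trans)
open import Data.List.Relation.Binary.Permutation.Propositional.Properties
  using (filter-↭; ↭-length; ∈-resp-↭; shift)
open import Data.List.Relation.Unary.All as All using (All; []; _∷_)
open import Data.List.Relation.Unary.All.Properties as All using (all-filter)
open import Data.List.Relation.Unary.AllPairs using (_∷_)
open import Data.List.Relation.Unary.Any as Any using (Any; here; there)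
open import Data.List.Relation.Unary.Any.Properties as Any using (lookup-index)
open import Data.List.Relation.Unary.Unique.Propositional using (Unique)
import Data.List.Relation.Unary.Unique.Propositional.Properties as Unique
open import Data.Nat.Base using (ℕ; zero; suc; NonZero; _+_; _*_; _≤_; _<_; z≤n; s≤s; >-nonZero⁻¹)
open import Data.Nat.Properties
  using (≤-refl; ≤-reflexive; ≤-trans; <-≤-trans; ≤-<-trans; <⇒≤; <⇒≱; ≮⇒≥; ≤-pred;
         n≤1+n; m≤n⇒m≤1+n; m≤n+m; +-mono-≤; +-monoˡ-≤; +-monoʳ-≤; +-mono-<-≤; *-mono-≤;
         +-cancelˡ-≤; +-assoc; +-cancelʳ-≤; +-comm; +-identityʳ; +-suc; <-≤-connex; _≤?_;
         module ≤-Reasoning)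
open import Data.Nat.Tactic.RingSolver using (solve-∀)
open import Data.Product.Base using (∃; ∃₂; _×_; _,_; proj₁; proj₂; -,_)
open import Data.Sum.Base as Sum using (_⊎_; inj₁; inj₂; [_,_]′)
open import Data.Vec.Base using (tabulate)
open import Data.Vec.Properties using (lookup⇒[]=; []=⇒lookup; lookup∘tabulate)
open import Function.Base using (_∘_; id; case_of_)
open import Level using (0ℓ)
open import Relation.Binary.Core using (Rel)
open import Relation.Binary.Definitions as B using (tri<; tri≈; tri>)
open import Relation.Binary.PropositionalEquality
  using (_≡_; _≢_; refl; sym; trans; cong; subst; subst₂)
open import Relation.Nullary
  using (¬_; yes; no; does; ¬?; _×-dec_; _⊎-dec_; contradiction; decidable-stable)
open import Relation.Nullary.Decidable using (dec-true)
open import Relation.Unary using (Pred; Decidable)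
open import Defs

-- Counting in lists.

module _ {A : Set} where

  count : {P : Pred A 0ℓ} → Decidable P → List A → ℕ
  count P? xs = length (filter P? xs)

  module _ {P : Pred A 0ℓ} (P? : Decidable P) where

    count-++ : ∀ xs ys → count P? (xs ++ ys) ≡ count P? xs + count P? ys
    count-++ xs ys = trans (cong length (filter-++ P? xs ys)) (length-++ (filter P? xs))

    count-↭ : ∀ {xs ys} → xs ↭ ys → count P? xs ≡ count P? ys
    count-↭ = ↭-length ∘ filter-↭ P?

    count-insert-accept : ∀ xs {x ys} → P x →
                          count P? (xs ++ x ∷ ys) ≡ suc (count P? (xs ++ ys))
    count-insert-accept xs {x} {ys} px
      rewrite count-++ xs (x ∷ ys) | count-++ xs ys | filter-accept P? {xs = ys} px
      = +-suc _ _

    count-insert-reject : ∀ xs {x ys} → ¬ P x →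
                          count P? (xs ++ x ∷ ys) ≡ count P? (xs ++ ys)
    count-insert-reject xs {x} {ys} ¬px
      rewrite count-++ xs (x ∷ ys) | count-++ xs ys | filter-reject P? {xs = ys} ¬px
      = refl

    count-insert-≤ : ∀ xs {x ys} → count P? (xs ++ ys) ≤ count P? (xs ++ x ∷ ys)
    count-insert-≤ xs {x} with P? x
    ... | yes px = ≤-trans (n≤1+n _) (≤-reflexive (sym (count-insert-accept xs px)))
    ... | no ¬px = ≤-reflexive (sym (count-insert-reject xs ¬px))

    count-atMostOne : ∀ {xs} → Unique xs → (∀ {x y} → P x → P y → x ≡ y) → count P? xs ≤ 1
    count-atMostOne {xs} uniq same = bound (Unique.filter⁺ P? uniq) (all-filter P? xs)
      where
      bound : ∀ {ys} → Unique ys → All P ys → length ys ≤ 1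
      bound {[]}        _                   _              = z≤n
      bound {_ ∷ []}    _                   _              = s≤s z≤n
      bound {_ ∷ _ ∷ _} ((x≢y ∷ _) ∷ _) (px ∷ py ∷ _) = contradiction (same px py) x≢y

  module _ {P Q : Pred A 0ℓ} (P? : Decidable P) (Q? : Decidable Q) where

    count-mono : ∀ {xs} → All (λ x → P x → Q x) xs → count P? xs ≤ count Q? xs
    count-mono []                      = z≤n
    count-mono {x ∷ _} (px⇒qx ∷ rest) with P? x | Q? x
    ... | yes _  | yes _  = s≤s (count-mono rest)
    ... | yes px | no ¬qx = contradiction (px⇒qx px) ¬qx
    ... | no _   | yes _  = m≤n⇒m≤1+n (count-mono rest)
    ... | no _   | no _   = count-mono rest

    count-mono-< : ∀ {xs} → All (λ x → P x → Q x) xs → Any (λ x → Q x × ¬ P x) xs →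
                   count P? xs < count Q? xs
    count-mono-< {x ∷ _} (_ ∷ rest) (here (qx , ¬px)) with P? x | Q? x
    ... | yes px | _      = contradiction px ¬px
    ... | no _   | yes _  = s≤s (count-mono rest)
    ... | no _   | no ¬qx = contradiction qx ¬qx
    count-mono-< {x ∷ _} (px⇒qx ∷ rest) (there strict) with P? x | Q? x
    ... | yes _  | yes _  = s≤s (count-mono-< rest strict)
    ... | yes px | no ¬qx = contradiction (px⇒qx px) ¬qx
    ... | no _   | yes _  = m≤n⇒m≤1+n (count-mono-< rest strict)
    ... | no _   | no _   = count-mono-< rest strict

    count-⊎ : ∀ xs → count (λ x → P? x ⊎-dec Q? x) xs ≤ count P? xs + count Q? xs
    count-⊎ []       = z≤n
    count-⊎ (x ∷ xs) with P? x | Q? x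
    ... | yes _ | yes _ = s≤s (≤-trans (count-⊎ xs) (+-monoʳ-≤ (count P? xs) (n≤1+n _)))
    ... | yes _ | no _  = s≤s (count-⊎ xs)
    ... | no _  | yes _ = ≤-trans (s≤s (count-⊎ xs)) (≤-reflexive (sym (+-suc _ _)))
    ... | no _  | no _  = count-⊎ xs

-- Median orders.

module MedianOrder {A : Set} {_⟶_ : Rel A 0ℓ} (_⟶?_ : B.Decidable _⟶_) where

  forward : List A → ℕ
  forward []       = 0
  forward (x ∷ xs) = count (x ⟶?_) xs + forward xs

  Median : Pred (List A) 0ℓ
  Median xs = ∀ {ys} → ys ↭ xs → forward ys ≤ forward xs

  forward-≤ : ∀ xs → forward xs ≤ length xs * length xs
  forward-≤ []       = z≤n
  forward-≤ (x ∷ xs) = m≤n⇒m≤1+n (+-mono-≤ (length-filter (x ⟶?_) xs)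
    (≤-trans (forward-≤ xs) (*-mono-≤ (≤-refl {length xs}) (n≤1+n _))))

  -- Passing to a better order must stop, since `forward` is bounded. Whether a better order exists
  -- is not decided, hence the double negation.
  median-exists : ∀ xs → ¬ ¬ ∃ λ ys → ys ↭ xs × Median ys
  median-exists xs none = climb bound xs ↭-refl (m≤n+m bound _)
    where
    bound = length xs * length xs
    -- `k` bounds what `forward ys` can still gain before it reaches `bound`.
    climb : ∀ k ys → ys ↭ xs → ¬ (bound ≤ forward ys + k)
    climb k ys ys↭xs close = none (ys , ys↭xs , λ zs↭ys → ≮⇒≥ (higher k close zs↭ys))
      where
      higher : ∀ k → bound ≤ forward ys + k → ∀ {zs} → zs ↭ ys → ¬ (forward ys < forward zs)
      higher zero close {zs} zs↭ys lt = <⇒≱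
        (≤-<-trans (≤-trans close (≤-reflexive (+-identityʳ _))) lt)
        (subst (λ l → forward zs ≤ l * l) (↭-length (↭-trans zs↭ys ys↭xs)) (forward-≤ zs))
      higher (suc k) close {zs} zs↭ys lt = climb k zs (↭-trans zs↭ys ys↭xs)
        (≤-trans close (≤-trans (≤-reflexive (+-suc _ k)) (+-monoˡ-≤ k lt)))

  -- Isolates the forward arcs at `x`, so that two positions of `x` can be compared by cancelling
  -- the rest.
  forward-insert : ∀ qs {x ys} → forward (qs ++ x ∷ ys) ≡
                   count (_⟶? x) qs + (count (x ⟶?_) ys + forward (qs ++ ys))
  forward-insert []            = refl
  forward-insert (q ∷ qs) {x} {ys} rewrite forward-insert qs {x} {ys} with q ⟶? x
  ... | yes q⟶x rewrite count-insert-accept (q ⟶?_) qs {x} {ys} q⟶x =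
    accept (count (q ⟶?_) (qs ++ ys)) (count (_⟶? x) qs) (count (x ⟶?_) ys) (forward (qs ++ ys))
    where
    accept : ∀ a b c d → suc a + (b + (c + d)) ≡ suc b + (c + (a + d))
    accept = solve-∀
  ... | no ¬q⟶x rewrite count-insert-reject (q ⟶?_) qs {x} {ys} ¬q⟶x =
    reject (count (q ⟶?_) (qs ++ ys)) (count (_⟶? x) qs) (count (x ⟶?_) ys) (forward (qs ++ ys))
    where
    reject : ∀ a b c d → a + (b + (c + d)) ≡ b + (c + (a + d))
    reject = solve-∀

  forward-front : ∀ qs {x ys} → forward (x ∷ qs ++ ys) ≡
                  count (x ⟶?_) qs + (count (x ⟶?_) ys + forward (qs ++ ys))
  forward-front qs {x} {ys} rewrite count-++ (x ⟶?_) qs ys =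
    +-assoc (count (x ⟶?_) qs) (count (x ⟶?_) ys) (forward (qs ++ ys))

  median-tail : ∀ {x xs} → Median (x ∷ xs) → Median xs
  median-tail {x} {xs} median {ys} ys↭xs = +-cancelˡ-≤ (count (x ⟶?_) xs) _ _
    (subst (λ c → c + forward ys ≤ forward (x ∷ xs)) (count-↭ (x ⟶?_) ys↭xs)
           (median (prep x ys↭xs)))

  median-suffix : ∀ qs {xs} → Median (qs ++ xs) → Median xs
  median-suffix []       median = median
  median-suffix (q ∷ qs) median = median-suffix qs (median-tail median)

  -- Moving `x` in front of `qs` trades the arcs from `qs` into `x` for those from `x` into `qs`,
  -- and must not be a gain.
  median-out≤in : ∀ qs {x ys} → Median (qs ++ x ∷ ys) → count (x ⟶?_) qs ≤ count (_⟶? x) qs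
  median-out≤in qs {x} {ys} median = +-cancelʳ-≤ _ _ _
    (subst₂ _≤_ (forward-front qs) (forward-insert qs) (median (↭-sym (shift x qs ys))))

  -- The same move is now no loss, so the new order attains the maximum too.
  median-front : ∀ qs {x ys} → count (_⟶? x) qs ≤ count (x ⟶?_) qs →
                 Median (qs ++ x ∷ ys) → Median (x ∷ qs ++ ys)
  median-front qs {x} {ys} in≤out median zs↭ =
    ≤-trans (median (↭-trans zs↭ (↭-sym (shift x qs ys))))
            (subst₂ _≤_ (sym (forward-insert qs)) (sym (forward-front qs)) (+-monoˡ-≤ _ in≤out))

  -- `N` will be the out-neighborhood of `v` in `D`, and `G` its second neighborhood, enlarged by
  -- the lost vertices if `v` is a leaf. The relation `_⟶_` may have arcs out of `v` that `N` does
  -- not record; those ending in `G` make the inequality strict.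
  module Feed (asym : ∀ {x y} → x ⟶ y → ¬ (y ⟶ x)) (v : A)
              {N G : Pred A 0ℓ} (N? : Decidable N) (G? : Decidable G)
              (N⇒out : ∀ {r} → N r → v ⟶ r)
              (dominates : ∀ {b r} → ¬ N b → ¬ G b → N r → b ⟶ r) where

    Extra : Pred A 0ℓ
    Extra r = G r × ¬ N r × v ⟶ r

    Bound : Pred (List A) 0ℓ
    Bound xs = count N? xs ≤ count G? xs × (Any Extra xs → count N? xs < count G? xs)

    any-delete : ∀ qs {x xs} → ¬ Extra x → Any Extra (qs ++ x ∷ xs) → Any Extra (qs ++ xs)
    any-delete qs ¬ex any with Any.++⁻ qs any
    ... | inj₁ inQ         = Any.++⁺ˡ inQ
    ... | inj₂ (here ex)   = contradiction ex ¬ex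
    ... | inj₂ (there inX) = Any.++⁺ʳ qs inX

    bound-insert : ∀ qs {x xs} → ¬ N x → ¬ Extra x → Bound (qs ++ xs) → Bound (qs ++ x ∷ xs)
    bound-insert qs {x} {xs} ¬nx ¬ex (n≤g , n<g)
      rewrite count-insert-reject N? qs {x} {xs} ¬nx =
        ≤-trans n≤g (count-insert-≤ G? qs) ,
        λ any → <-≤-trans (n<g (any-delete qs ¬ex any)) (count-insert-≤ G? qs)

    NorG : Pred A 0ℓ
    NorG r = N r ⊎ G r

    -- A vertex x outside N and G that has passed qs may be moved in front of it without
    -- loss when qs has at least as many vertices of N as of G; otherwise qs itself
    -- accounts for the strict inequality.
    bound-median : ∀ qs xs → All NorG qs → Median (qs ++ xs ∷ʳ v) → Bound (qs ++ xs ∷ʳ v)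
    bound-median qs [] all median =
      bound-insert qs (λ nv → asym (N⇒out nv) (N⇒out nv)) (λ (_ , _ , vv) → asym vv vv)
        (subst Bound (sym (++-identityʳ qs)) (n≤g , n<g))
      where
      -- Everything before `v` is now in `N` or `G`, and `v` beats `N`, so arcs into `v` come from
      -- `G`; optimality at `v` bounds its out-arcs by their number.
      in⇒G : All (λ r → r ⟶ v → G r) qs
      in⇒G = All.map (λ nOrG rv → [ (λ nr → contradiction rv (asym (N⇒out nr))) , id ]′ nOrG) all
      out≤g : count (v ⟶?_) qs ≤ count G? qs
      out≤g = ≤-trans (median-out≤in qs median) (count-mono (_⟶? v) G? in⇒G)
      N⇒out′ : All (λ r → N r → v ⟶ r) qs
      N⇒out′ = All.universal (λ _ → N⇒out) qs
      n≤g : count N? qs ≤ count G? qs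
      n≤g = ≤-trans (count-mono N? (v ⟶?_) N⇒out′) out≤g
      n<g : Any Extra qs → count N? qs < count G? qs
      n<g any = <-≤-trans
        (count-mono-< N? (v ⟶?_) N⇒out′ (Any.map (λ (_ , ¬n , out) → out , ¬n) any)) out≤g
    bound-median qs (x ∷ xs) all median with N? x ⊎-dec G? x
    ... | yes nOrG = subst Bound (++-assoc qs [ x ] _)
      (bound-median (qs ∷ʳ x) xs (All.∷ʳ⁺ all nOrG)
        (λ {ys} → subst Median (sym (++-assoc qs [ x ] _)) median {ys}))
    ... | no ¬nOrG with <-≤-connex (count N? qs) (count G? qs)
    ...   | inj₁ n<g = <⇒≤ total , λ _ → total
      where
      rest : Bound (xs ∷ʳ v)
      -- The suffix behind `x` is again a median order ending in `v`, so the argument restarts there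
      -- with nothing passed.
      rest = bound-median [] xs [] (median-tail (median-suffix qs median))
      total : count N? (qs ++ x ∷ xs ∷ʳ v) < count G? (qs ++ x ∷ xs ∷ʳ v)
      total = begin-strict
        count N? (qs ++ x ∷ xs ∷ʳ v)            ≡⟨ count-insert-reject N? qs (¬nOrG ∘ inj₁) ⟩
        count N? (qs ++ xs ∷ʳ v)                ≡⟨ count-++ N? qs _ ⟩
        count N? qs + count N? (xs ∷ʳ v)        <⟨ +-mono-<-≤ n<g (proj₁ rest) ⟩
        count G? qs + count G? (xs ∷ʳ v)        ≡⟨ count-++ G? qs _ ⟨
        count G? (qs ++ xs ∷ʳ v)                ≤⟨ count-insert-≤ G? qs ⟩
        count G? (qs ++ x ∷ xs ∷ʳ v)            ∎
        where open ≤-Reasoning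
    ...   | inj₂ g≤n = bound-insert qs (¬nOrG ∘ inj₁) (¬nOrG ∘ inj₂ ∘ proj₁)
      (bound-median qs xs all (median-tail (median-front qs in≤out median)))
      where
      x⟶N : ∀ {r} → N r → x ⟶ r
      x⟶N = dominates (¬nOrG ∘ inj₁) (¬nOrG ∘ inj₂)
      in⇒G : All (λ r → r ⟶ x → G r) qs
      in⇒G = All.map (λ nOrG rx → [ (λ nr → contradiction rx (asym (x⟶N nr))) , id ]′ nOrG) all
      in≤out : count (_⟶? x) qs ≤ count (x ⟶?_) qs
      in≤out = ≤-trans (count-mono (_⟶? x) G? in⇒G)
        (≤-trans g≤n (count-mono N? (x ⟶?_) (All.universal (λ _ → x⟶N) qs)))


-- Decidable subsets and reaching within two steps.

module _ {m : ℕ} {P : Pred (Fin m) 0ℓ} (P? : Decidable P) where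

  ∈-subset⁺ : ∀ {x} → P x → x ∈ subset P?
  ∈-subset⁺ {x} px = lookup⇒[]= x _ (trans (lookup∘tabulate _ x) (dec-true (P? x) px))

  ∈-subset⁻ : ∀ {x} → x ∈ subset P? → P x
  ∈-subset⁻ {x} x∈ with P? x | trans (sym (lookup∘tabulate (does ∘ P?) x)) ([]=⇒lookup x∈)
  ... | yes px | _  = px
  ... | no _   | ()

  ∣subset∣ : ∣ subset P? ∣ ≡ count P? (allFin m)
  ∣subset∣ = along id
    where
    along : ∀ {k} (f : Fin k → Fin m) →
            ∣ tabulate (does ∘ P? ∘ f) ∣ ≡ count P? (List.tabulate f)
    along {zero}  f = refl
    along {suc k} f with P? (f zero)
    ... | yes _ = cong suc (along (f ∘ suc))
    ... | no _  = along (f ∘ suc)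

module _ {m : ℕ} (D : Digraph m) where
  open Digraph D

  Reaches : Rel (Fin m) 0ℓ
  Reaches v w = v ⟶ w ⊎ AtDistance2 D v w

  reaches⇒∈ : ∀ {v w} → Reaches v w → w ∈ N⁺ D v ∪ N⁺⁺ D v
  reaches⇒∈ {v} = x∈p∪q⁺ ∘ Sum.map (∈-subset⁺ (v ⟶?_)) (∈-subset⁺ (atDistance2? D v))

  ∈⇒reaches : ∀ {v w} → w ∈ N⁺ D v ∪ N⁺⁺ D v → Reaches v w
  ∈⇒reaches {v} = Sum.map (∈-subset⁻ (v ⟶?_)) (∈-subset⁻ (atDistance2? D v)) ∘
                  x∈p∪q⁻ (N⁺ D v) (N⁺⁺ D v)

  king⇒reaches : ∀ {v} → IsKing D v → ∀ w → v ≢ w → Reaches v w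
  king⇒reaches {v} king w v≢w =
    [ (λ w∈ → contradiction (sym (x∈⁅y⁆⇒x≡y v w∈)) v≢w) , ∈⇒reaches ]′
    (x∈p∪q⁻ ⁅ v ⁆ (N⁺ D v ∪ N⁺⁺ D v) (subst (w ∈_) (sym king) ∈⊤))

  ∈N⁻⇒arc : ∀ {v w} → w ∈ N⁻ D v → w ⟶ v
  ∈N⁻⇒arc {v} = ∈-subset⁻ (λ w → w ⟶? v)

∣p∣≥1⇒Nonempty : ∀ {m} {p : Subset m} → 1 ≤ ∣ p ∣ → Nonempty p
∣p∣≥1⇒Nonempty {m} {p} 1≤∣p∣ with nonempty? p
... | yes ne = ne
... | no ¬ne = case subst (1 ≤_) (trans (cong ∣_∣ (Empty-unique ¬ne)) (∣⊥∣≡0 m)) 1≤∣p∣ of λ ()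

-- Stars and the completed tournament.

module _ {m n : ℕ} (T : Digraph m) (T-tournament : IsTournament T)
         (S : Fin n → Star m) (disjoint : PairwiseDisjoint S) where

  open Star using (leaves)

  D : Digraph m
  D = T ∖ S

  open Digraph D
  open IsTournament T-tournament
  open IsOriented isOriented

  c : Fin n → Fin m
  c = center ∘ S

  same-star : ∀ {i j x} → x ∈ Star.vertices (S i) → x ∈ Star.vertices (S j) → i ≡ j
  same-star {i} {j} x∈i x∈j =
    decidable-stable (i ≟ j) λ i≢j → disjoint i j i≢j (_ , x∈p∩q⁺ (x∈i , x∈j))

  center∈ : ∀ i → c i ∈ Star.vertices (S i)
  center∈ i = x∈p∪q⁺ (inj₁ (x∈⁅x⁆ _))

  leaf∈ : ∀ {i x} → x ∈ leaves (S i) → x ∈ Star.vertices (S i)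
  leaf∈ = x∈p∪q⁺ ∘ inj₂

  center-injective : ∀ {i j} → c i ≡ c j → i ≡ j
  center-injective {i} {j} eq =
    same-star (center∈ i) (subst (_∈ Star.vertices (S j)) (sym eq) (center∈ j))

  leaf-injective : ∀ {i j x} → x ∈ leaves (S i) → x ∈ leaves (S j) → i ≡ j
  leaf-injective x∈i x∈j = same-star (leaf∈ x∈i) (leaf∈ x∈j)

  center∉leaves : ∀ i j → c i ∉ leaves (S j)
  center∉leaves i j ci∈ with refl ← same-star (center∈ i) (leaf∈ ci∈) =
    Star.center∉leaves (S i) ci∈

  asymD : ∀ {x y} → x ⟶ y → ¬ (y ⟶ x)
  asymD (xy , _) (yx , _) = noDigons _ _ xy yx

  irreflD : ∀ {x y} → x ⟶ y → x ≢ y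
  irreflD xy refl = asymD xy xy

  leaf↛center : ∀ {i u} → u ∈ leaves (S i) → ¬ (u ⟶ c i)
  leaf↛center u∈ (_ , noEdge) = noEdge (_ , inj₂ (refl , u∈))

  center↛leaf : ∀ {i u} → u ∈ leaves (S i) → ¬ (c i ⟶ u)
  center↛leaf u∈ (_ , noEdge) = noEdge (_ , inj₁ (refl , u∈))

  Spoke : Rel (Fin m) 0ℓ
  Spoke u w = ∃ λ i → u ∈ leaves (S i) × w ≡ c i

  spoke? : B.Decidable Spoke
  spoke? u w = any? λ i → (u ∈? leaves (S i)) ×-dec (w ≟ c i)

  data Adjacency (u w : Fin m) : Set where
    out   : u ⟶ w → Adjacency u w
    into  : w ⟶ u → Adjacency u w
    spoke : Spoke u w → Adjacency u w
    ekops : Spoke w u → Adjacency u w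

  adjacency : ∀ {u w} → u ≢ w → Adjacency u w
  adjacency {u} {w} u≢w with any? (λ i → Star.edge? (S i) u w)
  ... | yes (i , inj₁ (u≡c , w∈)) = ekops (i , w∈ , u≡c)
  ... | yes (i , inj₂ (w≡c , u∈)) = spoke (i , u∈ , w≡c)
  ... | no ¬edge with adjacent u w u≢w
  ...   | inj₁ uw = out (uw , ¬edge)
  ...   | inj₂ wu = into (wu , λ (i , e) → ¬edge (i , Sum.swap e))

  -- The completion of `D`, each missing edge being directed towards its center.
  _⟶ᴴ_ : Rel (Fin m) 0ℓ
  u ⟶ᴴ w = u ⟶ w ⊎ Spoke u w

  _⟶ᴴ?_ : B.Decidable _⟶ᴴ_
  u ⟶ᴴ? w = (u ⟶? w) ⊎-dec spoke? u w

  asymᴴ : ∀ {x y} → x ⟶ᴴ y → ¬ (y ⟶ᴴ x)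
  asymᴴ (inj₁ xy)             (inj₁ yx)             = asymD xy yx
  asymᴴ (inj₁ xy)             (inj₂ (i , y∈ , refl)) = center↛leaf y∈ xy
  asymᴴ (inj₂ (i , x∈ , refl)) (inj₁ yx)             = center↛leaf x∈ yx
  asymᴴ (inj₂ (i , x∈ , refl)) (inj₂ (j , y∈ , _))   = center∉leaves i j y∈

  -- An arc from `r` to `b` in `D` would put `b` at distance 2 from `v`. So `b` can fail to beat `r`
  -- only if the two form a missing edge with center `b`.
  dominates-or-spoke : ∀ {v b r} → v ⟶ r → ¬ (v ⟶ b) → ¬ AtDistance2 D v b →
                       b ⟶ᴴ r ⊎ Spoke r b
  dominates-or-spoke {v} {b} {r} vr ¬vb ¬vvb with v ≟ b
  ... | yes refl = inj₁ (inj₁ vr)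
  ... | no v≢b with adjacency {b} {r} (λ { refl → ¬vb vr })
  ...   | out br   = inj₁ (inj₁ br)
  ...   | into rb  = contradiction (v≢b , ¬vb , r , vr , rb) ¬vvb
  ...   | spoke s  = inj₁ (inj₂ s)
  ...   | ekops s  = inj₂ s

  count≤⇒d⁺≤d⁺⁺ : ∀ {v L} → L ↭ allFin m →
                  count (v ⟶?_) L ≤ count (atDistance2? D v) L → d⁺ D v ≤ d⁺⁺ D v
  count≤⇒d⁺≤d⁺⁺ {v} p = subst₂ _≤_
    (trans (count-↭ (v ⟶?_) p) (sym (∣subset∣ (v ⟶?_))))
    (trans (count-↭ (atDistance2? D v) p) (sym (∣subset∣ (atDistance2? D v))))

  -- Missing edges and losing.

  missing-edge-listed : ∀ {u w} → Missing D (u , w) →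
    ∃ λ k → List.lookup (missingEdges D) k ∈ˡ (u , w) ∷ (w , u) ∷ []
  missing-edge-listed {u} {w} miss@(u≢w , ¬uw , ¬wu) with <-cmp u w
  ... | tri< u<w _ _ = _ , here (sym (lookup-index
    (∈-filter⁺ _ (∈-cartesianProduct⁺ (∈-allFin u) (∈-allFin w)) (u<w , miss))))
  ... | tri≈ _ u≡w _ = contradiction u≡w u≢w
  ... | tri> _ _ w<u = _ , there (here (sym (lookup-index
    (∈-filter⁺ _ (∈-cartesianProduct⁺ (∈-allFin w) (∈-allFin u))
      (w<u , u≢w ∘ sym , ¬wu , ¬uw)))))

  lookup-missing : ∀ k → Missing D (List.lookup (missingEdges D) k)
  lookup-missing k = proj₂ (proj₂ (∈-filter⁻ {P = λ (x , y) → x Fin.< y × Missing D (x , y)} _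
    {xs = List.cartesianProduct (allFin m) (allFin m)} (∈-lookup {xs = missingEdges D} k)))

  missing-spoke : ∀ {p q} → Missing D (p , q) → Spoke p q ⊎ Spoke q p
  missing-spoke (p≢q , ¬pq , ¬qp) with adjacency p≢q
  ... | out pq  = contradiction pq ¬pq
  ... | into qp = contradiction qp ¬qp
  ... | spoke s = inj₁ s
  ... | ekops s = inj₂ s

  swap-missing : ∀ {x y} → Missing D (x , y) → Missing D (y , x)
  swap-missing (x≢y , ¬xy , ¬yx) = x≢y ∘ sym , ¬yx , ¬xy

  swap-loses : ∀ {x y x′ y′} → LosesVia D (x , y) (x′ , y′) → LosesVia D (y , x) (y′ , x′)
  swap-loses (xx′ , y′∉ , yy′ , x′∉) = yy′ , x′∉ , xx′ , y′∉

  -- Losing survives swapping the names of both edges at once, so every choice of namings reduces to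
  -- the prescribed one `(x , y)`.
  loser-named : ∀ {e′ e x y} → Missing D e′ → e ∈ˡ namings D (x , y) → LosesTo D e′ e →
                ∃₂ λ p q → Missing D (p , q) × LosesVia D (p , q) (x , y)
  loser-named mi (here refl) (here (here lv))                 = -, -, mi , lv
  loser-named mi (here refl) (here (there (here lv)))         = -, -, swap-missing mi , swap-loses lv
  loser-named mi (here refl) (there (here (here lv)))         = -, -, swap-missing mi , lv
  loser-named mi (here refl) (there (here (there (here lv)))) = -, -, mi , swap-loses lv
  loser-named mi (there (here refl)) (here (here lv))         = -, -, swap-missing mi , swap-loses lv
  loser-named mi (there (here refl)) (here (there (here lv))) = -, -, mi , lv
  loser-named mi (there (here refl)) (there (here (here lv))) = -, -, mi , swap-loses lv
  loser-named mi (there (here refl)) (there (here (there (here lv)))) =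
    -, -, swap-missing mi , lv

  reaches-via : ∀ {x u w} → x ⟶ u → u ⟶ w → x ≢ w → Reaches D x w
  reaches-via {x} {u} {w} xu uw x≢w with x ⟶? w
  ... | yes xw = inj₁ xw
  ... | no ¬xw = inj₂ (x≢w , ¬xw , u , xu , uw)

  module _ (kings : ∀ i → IsKing (induced D c) i) (δ⁻ : ∀ e → 1 ≤ d⁻ (Δ D) e) where

    -- A path of length 2 between centers in the induced tournament runs through a center and is a
    -- path of `D`.
    king : ∀ {i j} → i ≢ j → Reaches D (c i) (c j)
    king {i} {j} i≢j =
      Sum.map₂ (λ (_ , ¬ij , k , path) → i≢j ∘ center-injective , ¬ij , c k , path)
               (king⇒reaches (induced D c) (kings i) j i≢j)

    Δ-predecessor : ∀ k → ∃ λ e → Missing D e × LosesTo D e (List.lookup (missingEdges D) k)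
    Δ-predecessor k =
      let l , l∈ = ∣p∣≥1⇒Nonempty (δ⁻ k)
      in  List.lookup (missingEdges D) l , lookup-missing l ,
          ∈N⁻⇒arc (Δ D) l∈

    loser : ∀ {j b} → b ∈ leaves (S j) →
            ∃₂ λ p q → Missing D (p , q) × LosesVia D (p , q) (c j , b)
    loser {j} {b} b∈ =
      let k , listed   = missing-edge-listed
                           ((λ { refl → center∉leaves j j b∈ }) , center↛leaf b∈ , leaf↛center b∈)
          _ , mi , lose = Δ-predecessor k
      in  loser-named mi listed lose

    -- An edge losing to b (c j) pairs its center with c j: if it paired it with b, then
    -- c j would be unreachable within two steps from a center, which is a king.
    predecessor : ∀ {j b} → b ∈ leaves (S j) → ∃ λ i → c i ⟶ c j × ¬ Reaches D (c i) b
    predecessor {j} {b} b∈ =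
      let _ , _ , mi , loses = loser b∈ in named (missing-spoke mi) loses
      where
      named : ∀ {p q} → Spoke p q ⊎ Spoke q p → LosesVia D (p , q) (c j , b) →
              ∃ λ i → c i ⟶ c j × ¬ Reaches D (c i) b
      named (inj₂ (i , _ , refl)) (ij , b∉ , _ , _)  = i , ij , b∉ ∘ reaches⇒∈ D
      named (inj₁ (i , _ , refl)) (_ , _ , ib , cj∉) =
        contradiction (reaches⇒∈ D (king λ { refl → center↛leaf b∈ ib })) cj∉

  -- Lost vertices and the last vertex of a median order.

  module _ (king : ∀ {i j} → i ≢ j → Reaches D (c i) (c j))
           (predecessor : ∀ {j b} → b ∈ leaves (S j) → ∃ λ i → c i ⟶ c j × ¬ Reaches D (c i) b)
           where

    -- Some center `c i` beats `c j` without reaching `v`. Since `v` is a leaf of no star but `S j`,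
    -- it is not joined to `c i` by a missing edge, so `v` beats `c i`.
    center-at-distance-2 : ∀ {j v} → v ∈ leaves (S j) → AtDistance2 D v (c j)
    center-at-distance-2 {j} {v} v∈ = via (predecessor v∈)
      where
      v≢ : ∀ i → v ≢ c i
      v≢ i refl = center∉leaves i j v∈
      via : (∃ λ i → c i ⟶ c j × ¬ Reaches D (c i) v) → AtDistance2 D v (c j)
      via (i , ij , ¬iv) with adjacency (v≢ i)
      ... | out vi             = v≢ j , leaf↛center v∈ , c i , vi , ij
      ... | into iv            = contradiction (inj₁ iv) ¬iv
      ... | spoke (l , v∈l , eq) = contradiction
        (trans eq (cong c (leaf-injective v∈l v∈))) (irreflD ij)
      ... | ekops (l , ci∈ , _) = contradiction ci∈ (center∉leaves i l)

    -- Take a center `c i` that beats `c k` and does not reach `r`. It cannot beat `v`, which beats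
    -- `r`. So `v` is `c i`, beats `c i`, or is a leaf at `c i`; in the first two cases `v` reaches
    -- `c k`.
    crossing : ∀ {k r v} → r ∈ leaves (S k) → v ⟶ r →
               Reaches D v (c k) ⊎
               ∃ λ i → v ∈ leaves (S i) × c i ⟶ c k × ¬ Reaches D (c i) r
    crossing {k} {r} {v} r∈ vr = via (predecessor r∈)
      where
      via : (∃ λ i → c i ⟶ c k × ¬ Reaches D (c i) r) →
            Reaches D v (c k) ⊎ ∃ λ i → v ∈ leaves (S i) × c i ⟶ c k × ¬ Reaches D (c i) r
      via (i , ik , ¬ir) with v ≟ c i
      ... | yes refl = inj₁ (king λ { refl → center↛leaf r∈ vr })
      ... | no v≢ci with adjacency v≢ci
      ...   | out vi  = inj₁ (reaches-via vi ik λ { refl → center↛leaf r∈ vr })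
      ...   | into iv = contradiction (reaches-via iv vr λ { refl → center∉leaves i k r∈ }) ¬ir
      ...   | spoke (l , v∈ , eq) with refl ← center-injective eq = inj₂ (i , v∈ , ik , ¬ir)
      ...   | ekops (l , ci∈ , _) = contradiction ci∈ (center∉leaves i l)

    -- The vertices in the second neighborhood of v in the completed tournament that may
    -- be missing from the one in D.
    Lost : Rel (Fin m) 0ℓ
    Lost v b = ¬ Reaches D v b × ∃ λ r → v ⟶ r × Spoke r b

    lost? : B.Decidable Lost
    lost? v b = ¬? ((v ⟶? b) ⊎-dec atDistance2? D v b) ×-dec
                any? λ r → (v ⟶? r) ×-dec spoke? r b

    -- For lost `c k` and `c l`, `v` is a leaf at one center `c i` that beats both and does not
    -- reach `r`. Then `r` beating `c l` would let `v` reach `c l`, `c l` beating `r` would let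
    -- `c i` reach `r`, and a missing edge would put `r` in two stars.
    lost-unique : ∀ {v b b′} → Lost v b → Lost v b′ → b ≡ b′
    lost-unique {v} (¬vk , r , vr , k , r∈ , refl) (¬vl , r′ , vr′ , l , r′∈ , refl) =
      cong c (decidable-stable (k ≟ l) λ k≢l → absurd k≢l (crossing r∈ vr) (crossing r′∈ vr′))
      where
      absurd : k ≢ l →
               Reaches D v (c k) ⊎ (∃ λ i → v ∈ leaves (S i) × c i ⟶ c k × ¬ Reaches D (c i) r) →
               Reaches D v (c l) ⊎ (∃ λ i → v ∈ leaves (S i) × c i ⟶ c l × ¬ Reaches D (c i) r′) →
               ⊥
      absurd _ (inj₁ vk) _ = ¬vk vk
      absurd _ _ (inj₁ vl) = ¬vl vl
      absurd k≢l (inj₂ (i , v∈i , ik , ¬ir)) (inj₂ (j , v∈j , jl , _))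
        with refl ← leaf-injective v∈i v∈j
        with adjacency {r} {c l} (λ { refl → center∉leaves l k r∈ })
      ... | out rl  = ¬vl (reaches-via vr rl λ { refl → center∉leaves l i v∈i })
      ... | into lr = ¬ir (reaches-via jl lr λ { refl → center∉leaves i k r∈ })
      ... | spoke (t , r∈t , eq) =
        k≢l (trans (leaf-injective r∈ r∈t) (sym (center-injective eq)))
      ... | ekops (t , cl∈ , _) = center∉leaves l t cl∈

    open MedianOrder _⟶ᴴ?_

    -- Without the leaf case of `crossing`, `v` reaches the center of any star having a leaf among
    -- its out-neighbors, so nothing is lost.
    nonleaf-feed : ∀ {v} A → ¬ (∃ λ j → v ∈ leaves (S j)) → A ∷ʳ v ↭ allFin m →
                   Median (A ∷ʳ v) → d⁺ D v ≤ d⁺⁺ D v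
    nonleaf-feed {v} A ¬leaf perm median =
      count≤⇒d⁺≤d⁺⁺ perm (proj₁ (bound-median [] A [] median))
      where
      dominates : ∀ {b r} → ¬ (v ⟶ b) → ¬ AtDistance2 D v b → v ⟶ r → b ⟶ᴴ r
      dominates ¬vb ¬vvb vr with dominates-or-spoke vr ¬vb ¬vvb
      ... | inj₁ br = br
      ... | inj₂ (k , r∈ , refl) with crossing r∈ vr
      ...   | inj₁ reach        = contradiction reach [ ¬vb , ¬vvb ]′
      ...   | inj₂ (i , v∈ , _) = contradiction (i , v∈) ¬leaf
      open Feed asymᴴ v (v ⟶?_) (atDistance2? D v) inj₁ dominates

    -- In the completed tournament v also beats its center, which is at distance 2 from v
    -- in D; the resulting strict inequality pays for the one lost vertex.
    leaf-feed : ∀ {j v} A → v ∈ leaves (S j) → A ∷ʳ v ↭ allFin m →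
                Median (A ∷ʳ v) → d⁺ D v ≤ d⁺⁺ D v
    leaf-feed {j} {v} A v∈ perm median = count≤⇒d⁺≤d⁺⁺ perm (≤-pred (begin-strict
      count (v ⟶?_) L                               <⟨ proj₂ (bound-median [] A [] median) extra ⟩
      count G? L                                    ≤⟨ count-⊎ (atDistance2? D v) (lost? v) L ⟩
      count (atDistance2? D v) L + count (lost? v) L ≤⟨ +-monoʳ-≤ _ one-lost ⟩
      count (atDistance2? D v) L + 1                ≡⟨ +-comm _ 1 ⟩
      suc (count (atDistance2? D v) L)              ∎))
      where
      open ≤-Reasoning
      L = A ∷ʳ v
      G? : Decidable (λ w → AtDistance2 D v w ⊎ Lost v w)
      G? w = atDistance2? D v w ⊎-dec lost? v w
      dominates : ∀ {b r} → ¬ (v ⟶ b) → ¬ (AtDistance2 D v b ⊎ Lost v b) → v ⟶ r → b ⟶ᴴ r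
      dominates ¬vb ¬g vr with dominates-or-spoke vr ¬vb (¬g ∘ inj₁)
      ... | inj₁ br = br
      ... | inj₂ s  = contradiction (inj₂ ([ ¬vb , ¬g ∘ inj₁ ]′ , _ , vr , s)) ¬g
      open Feed asymᴴ v (v ⟶?_) G? inj₁ dominates
      extra : Any Extra L
      extra = Any.map
        (λ { refl → inj₁ (center-at-distance-2 v∈) , leaf↛center v∈ , inj₂ (j , v∈ , refl) })
        (∈-resp-↭ (↭-sym perm) (∈-allFin (c j)))
      one-lost : count (lost? v) L ≤ 1
      one-lost = subst (_≤ 1) (sym (count-↭ (lost? v) perm))
        (count-atMostOne (lost? v) (Unique.allFin⁺ m) lost-unique)

    median⇒SNC : Fin m → ∀ {L} → L ↭ allFin m → Median L → SatisfiesSNC D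
    median⇒SNC x {L} perm median with initLast L
    ... | [] = case ∈-resp-↭ (↭-sym perm) (∈-allFin x) of λ ()
    ... | A ∷ʳ′ v with any? (λ j → v ∈? leaves (S j))
    ...   | yes (j , v∈) = v , leaf-feed A v∈ perm median
    ...   | no ¬leaf     = v , nonleaf-feed A ¬leaf perm median

    satisfiesSNC : Fin m → SatisfiesSNC D
    -- The conclusion is decidable, so the doubly negated existence of a median order suffices.
    satisfiesSNC x = decidable-stable (any? λ v → d⁺ D v ≤? d⁺⁺ D v) λ ¬snc →
      median-exists (allFin m) λ (_ , perm , median) → ¬snc (median⇒SNC x perm median)

theorem2 : ∀ {m n : ℕ} .{{_ : NonZero n}}
    (T : Digraph m) → IsTournament T →
    (S : Fin n → Star m) → PairwiseDisjoint S →
    let D = T ∖ S in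
    (∀ i → IsKing (induced D (center ∘ S)) i) →
    (∀ e → 1 ≤ d⁻ (Δ D) e) →
    SatisfiesSNC D
theorem2 {n = n} T T-tournament S disjoint kings δ⁻ =
  satisfiesSNC T T-tournament S disjoint
    (king T T-tournament S disjoint kings δ⁻)
    (predecessor T T-tournament S disjoint kings δ⁻)
    -- The center of the first star shows that the vertex set, and so the median order, is nonempty.
    (center (S (fromℕ< (>-nonZero⁻¹ n))))
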